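{- Fix $N\in\mathbb{N}$. Let $\theta\in(0,1]$, $(a_n)_{n=1}^\infty=\mathcal{G}(\theta)$, and $e_m=\theta-\sum_{n=1}^m 1/a_n$ for $m\geqslant 0$. Let $m\geqslant 1$ and let $N/b_m$ (with $b_m\in\mathbb{N}$) be the largest fraction with numerator $N$ and positive integer denominator that is strictly smaller than $e_{m-1}$. The following are equivalent: i) $a_{m+1}\geqslant N a_m^2-a_m+1$; ii) $1/a_m=N/b_m$; iii) $\Phi(e_{m-1})\geqslant N$; iv) $e_{m-1}\leqslant N/(Na_m-1)$.
   Context: $\mathbb{N}$ is the set of positive integers. For $\theta\in(0,1]$ let $G(\theta)=\lfloor 1/\theta\rfloor+1$. The greedy algorithm $\mathcal{G}$ produces the sequence $\mathcal{G}(\theta)=(a_n)_{n=1}^\infty$ of positive integers defined by $a_1=G(\theta)$ and $a_m=G\left(\theta-\sum_{n=1}^{m-1}1/a_n\right)$ for $m\geqslant 2$. The function $\Phi:(0,1]\to[1,\infty)$ is defined by $\Phi(\theta)=\frac{1}{1-\{\theta^{ -1}\}}=\frac{1}{G(\theta)-1/\theta}$, where $\{x\}=x-\lfloor x\rfloor$. -}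

module Defs where

open import Data.Nat.Base as ℕ using (ℕ; zero; suc)
open import Data.Integer.Base as ℤ using (ℤ; +_)
import Data.Integer.Properties as ℤ
import Data.Nat.Properties as ℕ
import Data.Rational.Unnormalised.Base as ℚᵘ
import Data.Rational.Unnormalised.Properties as ℚᵘ
open import Data.Rational.Base hiding (floor)
open import Data.Rational.Properties
open import Data.Rational.Solver using (module +-*-Solver)
open import Data.Product.Base using (∃-syntax; Σ-syntax; _×_; _,_; proj₁; proj₂)
open import Data.Sum.Base using (_⊎_; inj₁; inj₂)
open import Data.Empty using (⊥-elim)
open import Relation.Nullary.Decidable using (yes; no; from-yes)
open import Relation.Binary.PropositionalEquality
  using (_≡_; refl; sym; trans; cong; subst; module ≡-Reasoning)

p-q+q≡p : ∀ p q → (p - q) + q ≡ p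
p-q+q≡p = solve 2 (λ p q → (p :- q) :+ q := p) refl
  where open +-*-Solver

p+q-q≡p : ∀ p q → (p + q) - q ≡ p
p+q-q≡p = solve 2 (λ p q → (p :+ q) :- q := p) refl
  where open +-*-Solver

q-[q-p]≡p : ∀ p q → q - (q - p) ≡ p
q-[q-p]≡p = solve 2 (λ p q → q :- (q :- p) := p) refl
  where open +-*-Solver

p<q⇒0<q-p : ∀ {p q} → p < q → 0ℚ < q - p
p<q⇒0<q-p {p} {q} p<q = subst (_< q - p) (+-inverseʳ p) (+-monoˡ-< (- p) p<q)

infixl 7 _÷⁺_
_÷⁺_ : ℚ → {r : ℚ} → 0ℚ < r → ℚ
_÷⁺_ p {r} 0<r = p * (1/ r) {{pos⇒nonZero r {{positive 0<r}}}}

÷⁺-* : ∀ p {r} (0<r : 0ℚ < r) → (p ÷⁺ 0<r) * r ≡ p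
÷⁺-* p {r} 0<r = begin
  (p * 1/ r) * r ≡⟨ *-assoc p (1/ r) r ⟩
  p * (1/ r * r) ≡⟨ cong (p *_) (*-inverseˡ r) ⟩
  p * 1ℚ         ≡⟨ *-identityʳ p ⟩
  p              ∎
  where
  open ≡-Reasoning
  instance
    r≢0 : NonZero r
    r≢0 = pos⇒nonZero r {{positive 0<r}}

cancel-* : ∀ {p q r} → 0ℚ < r → p * r < q * r → p < q
cancel-* {r = r} 0<r = *-cancelʳ-<-nonNeg r {{pos⇒nonNeg r {{positive 0<r}}}}

mono-* : ∀ {p q r} → 0ℚ < r → p < q → p * r < q * r
mono-* {r = r} 0<r = *-monoˡ-<-pos r {{positive 0<r}}

0<1 : 0ℚ < 1ℚ
0<1 = from-yes (0ℚ <? 1ℚ)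

1/n*n≡1 : ∀ n .{{_ : ℕ.NonZero n}} → (+ 1 / n) * (+ n / 1) ≡ 1ℚ
1/n*n≡1 n@(suc n-1) = toℚᵘ-injective (begin
  toℚᵘ ((+ 1 / n) * (+ n / 1))            ≈⟨ toℚᵘ-homo-* (+ 1 / n) (+ n / 1) ⟩
  toℚᵘ (+ 1 / n) ℚᵘ.* toℚᵘ (+ n / 1)      ≈⟨ ℚᵘ.*-cong (toℚᵘ-fromℚᵘ (ℚᵘ.mkℚᵘ (+ 1) n-1)) (toℚᵘ-fromℚᵘ (ℚᵘ.mkℚᵘ (+ n) 0)) ⟩
  ℚᵘ.mkℚᵘ (+ 1) n-1 ℚᵘ.* ℚᵘ.mkℚᵘ (+ n) 0  ≈⟨ ℚᵘ.*≡* (cong +_ (trans (trans (ℕ.*-identityʳ (1 ℕ.* n)) (trans (ℕ.*-identityˡ n) (sym (ℕ.*-identityʳ n)))) (sym (ℕ.*-identityˡ (n ℕ.* 1))))) ⟩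
  toℚᵘ 1ℚ                                 ∎)
  where open import Relation.Binary.Reasoning.Setoid ℚᵘ.≃-setoid

*-÷⁺ : ∀ p {r} (0<r : 0ℚ < r) → r * (p ÷⁺ 0<r) ≡ p
*-÷⁺ p {r} 0<r = trans (*-comm r (p ÷⁺ 0<r)) (÷⁺-* p 0<r)

-- Located two-sided Dedekind cuts: L q means q < x and U q means x < q.
record ℝ : Set₁ where
  field
    L U         : ℚ → Set
    L-inhabited : ∃[ q ] L q
    U-inhabited : ∃[ q ] U q
    L-down      : ∀ {q r} → q < r → L r → L q
    U-up        : ∀ {q r} → q < r → U q → U r
    L-open      : ∀ {q} → L q → ∃[ r ] q < r × L r
    U-open      : ∀ {r} → U r → ∃[ q ] q < r × U q
    L<U         : ∀ {q r} → L q → U r → q < r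
    located     : ∀ {q r} → q < r → L q ⊎ U r

open ℝ

infix 4 _≤ᵣ_ _<ᵣ_

_≤ᵣ_ : ℝ → ℝ → Set
x ≤ᵣ y = ∀ {q} → L x q → L y q

_<ᵣ_ : ℝ → ℝ → Set
x <ᵣ y = ∃[ q ] U x q × L y q

fromℚ : ℚ → ℝ
fromℚ p = record
  { L           = _< p
  ; U           = p <_
  ; L-inhabited = p - 1ℚ , subst (p - 1ℚ <_) (+-identityʳ p) (+-monoʳ-< p (from-yes (- 1ℚ <? 0ℚ)))
  ; U-inhabited = p + 1ℚ , subst (_< p + 1ℚ) (+-identityʳ p) (+-monoʳ-< p 0<1)
  ; L-down      = <-trans
  ; U-up        = λ q<r p<q → <-trans p<q q<r
  ; L-open      = <-dense
  ; U-open      = λ p<r → let s , p<s , s<r = <-dense p<r in s , s<r , p<s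
  ; L<U         = <-trans
  ; located     = loc
  }
  where
  loc : ∀ {q r} → q < r → q < p ⊎ p < r
  loc {q} q<r with q <? p
  ... | yes q<p = inj₁ q<p
  ... | no  q≮p = inj₂ (≤-<-trans (≮⇒≥ q≮p) q<r)

fromℤ : ℤ → ℝ
fromℤ k = fromℚ (k / 1)

infixl 6 _-ℚ_ _ℚ-_

_-ℚ_ : ℝ → ℚ → ℝ
x -ℚ c = record
  { L           = λ q → L x (q + c)
  ; U           = λ q → U x (q + c)
  ; L-inhabited = let q , Lq = L-inhabited x in q - c , subst (L x) (sym (p-q+q≡p q c)) Lq
  ; U-inhabited = let q , Uq = U-inhabited x in q - c , subst (U x) (sym (p-q+q≡p q c)) Uq
  ; L-down      = λ q<r → L-down x (+-monoˡ-< c q<r)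
  ; U-up        = λ q<r → U-up x (+-monoˡ-< c q<r)
  ; L-open      = λ Lq → let r , q+c<r , Lr = L-open x Lq in
                    r - c , cancel (subst (_ <_) (sym (p-q+q≡p r c)) q+c<r)
                          , subst (L x) (sym (p-q+q≡p r c)) Lr
  ; U-open      = λ Ur → let q , q<r+c , Uq = U-open x Ur in
                    q - c , cancel (subst (_< _) (sym (p-q+q≡p q c)) q<r+c)
                          , subst (U x) (sym (p-q+q≡p q c)) Uq
  ; L<U         = λ Lq Ur → cancel (L<U x Lq Ur)
  ; located     = λ q<r → located x (+-monoˡ-< c q<r)
  }
  where
  cancel : ∀ {q r} → q + c < r + c → q < r
  cancel {q} {r} lt =
    subst (q <_) (p+q-q≡p r c) (subst (_< (r + c) - c) (p+q-q≡p q c) (+-monoˡ-< (- c) lt))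

_ℚ-_ : ℚ → ℝ → ℝ
c ℚ- x = record
  { L           = λ q → U x (c - q)
  ; U           = λ q → L x (c - q)
  ; L-inhabited = let q , Uq = U-inhabited x in c - q , subst (U x) (sym (q-[q-p]≡p q c)) Uq
  ; U-inhabited = let q , Lq = L-inhabited x in c - q , subst (L x) (sym (q-[q-p]≡p q c)) Lq
  ; L-down      = λ q<r → U-up x (anti q<r)
  ; U-up        = λ q<r → L-down x (anti q<r)
  ; L-open      = λ {q} Uq → let r , r<c-q , Ur = U-open x Uq in
                    c - r , subst (_< c - r) (q-[q-p]≡p q c) (anti r<c-q)
                          , subst (U x) (sym (q-[q-p]≡p r c)) Ur
  ; U-open      = λ {r} Lr → let q , c-r<q , Lq = L-open x Lr in
                    c - q , subst (c - q <_) (q-[q-p]≡p r c) (anti c-r<q)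
                          , subst (L x) (sym (q-[q-p]≡p q c)) Lq
  ; L<U         = λ {q} {r} Uq Lr →
                    subst (_< r) (q-[q-p]≡p q c)
                      (subst (c - (c - q) <_) (q-[q-p]≡p r c) (anti (L<U x Lr Uq)))
  ; located     = λ q<r → flip⊎ (located x (anti q<r))
  }
  where
  anti : ∀ {q r} → q < r → c - r < c - q
  anti q<r = +-monoʳ-< c (neg-antimono-< q<r)
  flip⊎ : ∀ {A B : Set} → A ⊎ B → B ⊎ A
  flip⊎ (inj₁ a) = inj₂ a
  flip⊎ (inj₂ b) = inj₁ b

-- For x > 0, q < 1/x iff q * r < 1 for some r > x; this also covers q ≤ 0.
1/ᵣ : (x : ℝ) → fromℚ 0ℚ <ᵣ x → ℝ
1/ᵣ x (p , 0<p , Lp) = record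
  { L           = λ q → ∃[ r ] U x r × q * r < 1ℚ
  ; U           = λ q → ∃[ r ] L x r × 0ℚ < r × 1ℚ < q * r
  ; L-inhabited = let r , Ur = U-inhabited x in
                    0ℚ , r , Ur , subst (_< 1ℚ) (sym (*-zeroˡ r)) 0<1
  ; U-inhabited = let s , 1<s = U-inhabited (fromℚ 1ℚ) in
                    s ÷⁺ 0<p , p , Lp , 0<p , subst (1ℚ <_) (sym (÷⁺-* s 0<p)) 1<s
  ; L-down      = λ q<q′ (r , Ur , q′r<1) → r , Ur , <-trans (mono-* (0<U Ur) q<q′) q′r<1
  ; U-up        = λ q<q′ (r , Lr , 0<r , 1<qr) → r , Lr , 0<r , <-trans 1<qr (mono-* 0<r q<q′)
  ; L-open      = λ {q} (r , Ur , qr<1) →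
                    let s , qr<s , s<1 = <-dense qr<1
                        0<r = 0<U Ur
                    in s ÷⁺ 0<r , cancel-* 0<r (subst (q * r <_) (sym (÷⁺-* s 0<r)) qr<s)
                                , r , Ur , subst (_< 1ℚ) (sym (÷⁺-* s 0<r)) s<1
  ; U-open      = λ {q} (r , Lr , 0<r , 1<qr) →
                    let s , 1<s , s<qr = <-dense 1<qr
                    in s ÷⁺ 0<r , cancel-* 0<r (subst (_< q * r) (sym (÷⁺-* s 0<r)) s<qr)
                                , r , Lr , 0<r , subst (1ℚ <_) (sym (÷⁺-* s 0<r)) 1<s
  ; L<U         = cuts-ordered
  ; located     = loc
  }
  where
  0<U : ∀ {r} → U x r → 0ℚ < r
  0<U Ur = <-trans 0<p (L<U x Lp Ur)

  cuts-ordered : ∀ {q q′} → (∃[ r ] U x r × q * r < 1ℚ) →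
                 (∃[ r ] L x r × 0ℚ < r × 1ℚ < q′ * r) → q < q′
  cuts-ordered {q} {q′} (r , Ur , qr<1) (s , Ls , 0<s , 1<q′s) =
    cancel-* (0<U Ur) (<-trans qr<1 (<-trans 1<q′s q′s<q′r))
    where
    0<q′ : 0ℚ < q′
    0<q′ = cancel-* 0<s (subst (_< q′ * s) (sym (*-zeroˡ s)) (<-trans 0<1 1<q′s))
    q′s<q′r : q′ * s < q′ * r
    q′s<q′r = *-monoʳ-<-pos q′ {{positive 0<q′}} (L<U x Ls Ur)

  loc : ∀ {q q′} → q < q′ → (∃[ r ] U x r × q * r < 1ℚ) ⊎
                            (∃[ r ] L x r × 0ℚ < r × 1ℚ < q′ * r)
  loc {q} {q′} q<q′ with 0ℚ <? q
  ... | no 0≮q = let r , Ur = U-inhabited x in inj₁ (r , Ur , qr<1 r (0<U Ur))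
    where
    qr<1 : ∀ r → 0ℚ < r → q * r < 1ℚ
    qr<1 r 0<r = ≤-<-trans
      (subst (q * r ≤_) (*-zeroˡ r)
        (*-monoʳ-≤-nonNeg r {{pos⇒nonNeg r {{positive 0<r}}}} (≮⇒≥ 0≮q)))
      0<1
  ... | yes 0<q = between (<-dense 1/q′<1/q)
    where
    0<q′ : 0ℚ < q′
    0<q′ = <-trans 0<q q<q′
    1/q 1/q′ : ℚ
    1/q  = 1ℚ ÷⁺ 0<q
    1/q′ = 1ℚ ÷⁺ 0<q′
    0<1/q′ : 0ℚ < 1/q′
    0<1/q′ = cancel-* 0<q′
      (subst (_< 1/q′ * q′) (sym (*-zeroˡ q′)) (subst (0ℚ <_) (sym (÷⁺-* 1ℚ 0<q′)) 0<1))
    1/q′<1/q : 1/q′ < 1/q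
    1/q′<1/q = cancel-* 0<q (subst (1/q′ * q <_) (trans (÷⁺-* 1ℚ 0<q′) (sym (÷⁺-* 1ℚ 0<q)))
      (*-monoʳ-<-pos 1/q′ {{positive 0<1/q′}} q<q′))
    between : (∃[ s ] 1/q′ < s × s < 1/q) → _
    between (s , 1/q′<s , s<1/q) = decide (<-dense s<1/q)
      where
      decide : (∃[ t ] s < t × t < 1/q) → _
      decide (t , s<t , t<1/q) with located x s<t
      ... | inj₁ Ls = inj₂ (s , Ls , <-trans 0<1/q′ 1/q′<s
                            , subst (_< q′ * s) (*-÷⁺ 1ℚ 0<q′) (*-monoʳ-<-pos q′ {{positive 0<q′}} 1/q′<s))
      ... | inj₂ Ut = inj₁ (t , Ut
                            , subst (q * t <_) (*-÷⁺ 1ℚ 0<q) (*-monoʳ-<-pos q {{positive 0<q}} t<1/q))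

-- The integer part of a real cannot be computed from its cuts, so it is
-- specified: k = ⌊x⌋ iff k ≤ x < k + 1.  Given excluded middle, every real
-- has a floor.
record Floor (x : ℝ) : Set where
  field
    ⌊_⌋   : ℤ
    lower : fromℤ ⌊_⌋ ≤ᵣ x
    upper : x <ᵣ fromℤ (⌊_⌋ ℤ.+ + 1)

open Floor

frac : (x : ℝ) → Floor x → ℝ
frac x f = x -ℚ (⌊ f ⌋ / 1)

infix 4 _∈⟨0,1]

record _∈⟨0,1] (x : ℝ) : Set where
  field
    positiveᵣ : fromℚ 0ℚ <ᵣ x
    at-most-1 : x ≤ᵣ fromℚ 1ℚ

open _∈⟨0,1]

recip : (x : ℝ) → x ∈⟨0,1] → ℝ
recip x u = 1/ᵣ x (positiveᵣ u)

G : (x : ℝ) (u : x ∈⟨0,1]) → Floor (recip x u) → ℤ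
G x u f = ⌊ f ⌋ ℤ.+ + 1

[k+1]/1 : ∀ k → (k ℤ.+ + 1) / 1 ≡ k / 1 + 1ℚ
[k+1]/1 k = toℚᵘ-injective (begin
  toℚᵘ ((k ℤ.+ + 1) / 1)               ≈⟨ toℚᵘ-fromℚᵘ (ℚᵘ.mkℚᵘ (k ℤ.+ + 1) 0) ⟩
  ℚᵘ.mkℚᵘ (k ℤ.+ + 1) 0                ≈⟨ ℚᵘ.*≡* (cong (λ i → (i ℤ.+ + 1) ℤ.* + 1) (sym (ℤ.*-identityʳ k))) ⟩
  ℚᵘ.mkℚᵘ k 0 ℚᵘ.+ toℚᵘ 1ℚ             ≈⟨ ℚᵘ.+-congˡ (toℚᵘ 1ℚ) (ℚᵘ.≃-sym (toℚᵘ-fromℚᵘ (ℚᵘ.mkℚᵘ k 0))) ⟩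
  toℚᵘ (k / 1) ℚᵘ.+ toℚᵘ 1ℚ            ≈⟨ ℚᵘ.≃-sym (toℚᵘ-homo-+ (k / 1) 1ℚ) ⟩
  toℚᵘ (k / 1 + 1ℚ)                    ∎)
  where open import Relation.Binary.Reasoning.Setoid ℚᵘ.≃-setoid

Φ : (x : ℝ) (u : x ∈⟨0,1]) → Floor (recip x u) → ℝ
Φ x u f = 1/ᵣ (1ℚ ℚ- frac (recip x u) f) 0<1-frac
  where
  k : ℚ
  k = ⌊ f ⌋ / 1

  0<1-frac : fromℚ 0ℚ <ᵣ (1ℚ ℚ- frac (recip x u) f)
  0<1-frac =
    let q , Uq , q<k+1 = upper f
        q<k+1′ = subst (q <_) ([k+1]/1 ⌊ f ⌋) q<k+1
    in (k + 1ℚ) - q , p<q⇒0<q-p q<k+1′ , subst (U (recip x u)) (sym (undo k q)) Uq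
    where
    undo : ∀ k q → (1ℚ - ((k + 1ℚ) - q)) + k ≡ q
    undo = solve 2 (λ k q → (con 1ℚ :- ((k :+ con 1ℚ) :- q)) :+ k := q) refl
      where open +-*-Solver

-- Sequences are indexed from 1: the value of a at 0 is never used.
module _ (θ : ℝ) (a : ℕ → ℕ) {{a≢0 : ∀ {n} → ℕ.NonZero (a n)}} where

  partialSum : ℕ → ℚ
  partialSum zero    = 0ℚ
  partialSum (suc m) = partialSum m + + 1 / a (suc m)

  remainder : ℕ → ℝ
  remainder m = θ -ℚ partialSum m

  -- The premise that the remainder lies in the domain of G always holds, see
  -- remainder∈⟨0,1] below.
  IsGreedy : Set
  IsGreedy = ∀ m (u : remainder m ∈⟨0,1]) →
             Σ[ f ∈ Floor (recip (remainder m) u) ] + a (suc m) ≡ G (remainder m) u f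

  module _ (θ∈ : θ ∈⟨0,1]) (greedy : IsGreedy) where

    remainder∈⟨0,1] : ∀ m → remainder m ∈⟨0,1]
    remainder∈⟨0,1] zero = record
      { positiveᵣ = let q , 0<q , Lq = positiveᵣ θ∈ in
                    q , 0<q , subst (L θ) (sym (+-identityʳ q)) Lq
      ; at-most-1 = λ {q} Lq → at-most-1 θ∈ (subst (L θ) (+-identityʳ q) Lq)
      }
    remainder∈⟨0,1] (suc m) = record
      { positiveᵣ = r - 1/a , p<q⇒0<q-p 1/a<r , subst (L θ) (sym (split r)) Lr
      ; at-most-1 = λ {q} Lq → at-most-1 u (L-down θ (+-monoʳ-< q S<S+1/a) Lq)
      }
      where
      u = remainder∈⟨0,1] m
      f = proj₁ (greedy m u)
      S 1/a : ℚ
      S   = partialSum m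
      1/a = + 1 / a (suc m)
      split : ∀ r → (r - 1/a) + (S + 1/a) ≡ r + S
      split r = solve 3 (λ r i s → (r :- i) :+ (s :+ i) := r :+ s) refl r 1/a S
        where open +-*-Solver
      0<1/a : 0ℚ < 1/a
      0<1/a = positive⁻¹ 1/a {{normalize-pos 1 (a (suc m))}}
      S<S+1/a : S < S + 1/a
      S<S+1/a = subst (_< S + 1/a) (+-identityʳ S) (+-monoʳ-< S 0<1/a)
      q = proj₁ (upper f)
      r = proj₁ (proj₁ (proj₂ (upper f)))
      Lr : L θ (r + S)
      Lr = proj₁ (proj₂ (proj₁ (proj₂ (upper f))))
      0<r : 0ℚ < r
      0<r = proj₁ (proj₂ (proj₂ (proj₁ (proj₂ (upper f)))))
      1<qr : 1ℚ < q * r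
      1<qr = proj₂ (proj₂ (proj₂ (proj₁ (proj₂ (upper f)))))
      q<a : q < + a (suc m) / 1
      q<a = subst (λ i → q < i / 1) (sym (proj₂ (greedy m u))) (proj₂ (proj₂ (upper f)))
      1<ra : 1ℚ < r * (+ a (suc m) / 1)
      1<ra = <-trans 1<qr (subst (q * r <_) (*-comm (+ a (suc m) / 1) r) (mono-* 0<r q<a))
      1/a<r : 1/a < r
      1/a<r = cancel-* (positive⁻¹ (+ a (suc m) / 1) {{normalize-pos (a (suc m)) 1}})
                       (subst (_< r * (+ a (suc m) / 1)) (sym (1/n*n≡1 (a (suc m)))) 1<ra)

    private
      1<a : ∀ m → 1ℚ < + a (suc m) / 1
      1<a m =
        let u = remainder∈⟨0,1] m
            f , a≡k+1 = greedy m u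
            q , (r , Lr , 0<r , 1<qr) , q<k+1 = upper f
            0<q : 0ℚ < q
            0<q = cancel-* 0<r (subst (_< q * r) (sym (*-zeroˡ r)) (<-trans 0<1 1<qr))
            qr<q : q * r < q
            qr<q = subst (q * r <_) (*-identityʳ q)
                     (*-monoʳ-<-pos q {{positive 0<q}} (at-most-1 u Lr))
        in <-trans 1<qr (<-trans qr<q (subst (λ i → q < i / 1) (sym a≡k+1) q<k+1))

    N*a∸1≢0 : ∀ N .{{_ : ℕ.NonZero N}} m → ℕ.NonZero (N ℕ.* a (suc m) ℕ.∸ 1)
    N*a∸1≢0 (suc N) m with a (suc m) | 1<a m
    ... | 0           | 1<0 = ⊥-elim (<-asym 1<0 0<1)
    ... | 1           | 1<1 = ⊥-elim (<-irrefl refl 1<1)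
    ... | suc (suc _) | _   = _

record IsLargestBelow (N b : ℕ) .{{_ : ℕ.NonZero b}} (x : ℝ) : Set where
  field
    below   : fromℚ (+ N / b) <ᵣ x
    largest : ∀ c .{{_ : ℕ.NonZero c}} → fromℚ (+ N / c) <ᵣ x → + N / c ≤ + N / b

{-# OPTIONS --safe #-}

-- With c = N a_m − 1, each of the four statements says that N/c < e_{m-1} fails.
-- For iv this is the definition of ≤.  For iii, inverting twice turns Φ(e) < N
-- into 1/N < a_m − 1/e, hence 1/e < c/N.  For i, N/c = 1/(a_m c) + 1/a_m and
-- a_m c = N a_m² − a_m, so the condition is that 1/(a_m c) < e_m fails.  For ii,
-- 1/a_m = N/(N a_m) < e_{m-1} always, so N/b_m differs from 1/a_m exactly if
-- the next larger candidate N/c is still below e_{m-1}.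
module Submission where

open import Defs
open import Data.Empty using (⊥-elim)
open import Data.Nat.Base as ℕ using (ℕ; suc)
import Data.Nat.Properties as ℕ
open import Data.Integer.Base as ℤ using (ℤ; +_)
import Data.Integer.Properties as ℤ
import Data.Integer.Solver as ℤ
import Data.Rational.Unnormalised.Base as ℚᵘ
import Data.Rational.Unnormalised.Properties as ℚᵘ
open import Data.Rational.Base
  using (ℚ; Positive; 0ℚ; 1ℚ; toℚᵘ; positive; _/_; _<_; _≤_; _+_; _-_; _*_)
open import Data.Rational.Properties
open import Data.Rational.Solver using (module +-*-Solver)
open import Data.Product.Base using (∃-syntax; _×_; _,_; proj₁; proj₂)
open import Data.Sum.Base using (fromInj₁)
open import Function.Bundles using (_⇔_; mk⇔; Equivalence)
open import Function.Construct.Composition using (_⇔-∘_)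
open import Function.Construct.Symmetry using (⇔-sym)
open import Function.Related.TypeIsomorphisms using (¬-cong-⇔)
open import Relation.Nullary using (¬_)
open import Relation.Binary.PropositionalEquality
  using (_≡_; refl; sym; trans; cong; subst; module ≡-Reasoning)

open ℝ
open Floor
open IsLargestBelow

-- Arithmetic and order of fractions by cross-multiplication.

toℚᵘ-/ : ∀ i n .{{_ : ℕ.NonZero n}} → toℚᵘ (i / n) ℚᵘ.≃ i ℚᵘ./ n
toℚᵘ-/ i (suc n-1) = toℚᵘ-fromℚᵘ (ℚᵘ.mkℚᵘ i n-1)

module _ (i j : ℤ) (m n : ℕ) .{{_ : ℕ.NonZero m}} .{{_ : ℕ.NonZero n}} where

  private
    i/m≃ = toℚᵘ-/ i m
    j/n≃ = toℚᵘ-/ j n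

  /≡/ : i ℤ.* + n ≡ j ℤ.* + m → i / m ≡ j / n
  /≡/ eq = toℚᵘ-injective
    (ℚᵘ.≃-trans i/m≃ (ℚᵘ.≃-trans (cross m n eq) (ℚᵘ.≃-sym j/n≃)))
    where
    -- `ℚᵘ./` unfolds only at a successor denominator, hence the match.
    cross : ∀ m n .{{_ : ℕ.NonZero m}} .{{_ : ℕ.NonZero n}} →
            i ℤ.* + n ≡ j ℤ.* + m → i ℚᵘ./ m ℚᵘ.≃ j ℚᵘ./ n
    cross (suc _) (suc _) = ℚᵘ.*≡*

  /≤/ : (i / m ≤ j / n) ⇔ (i ℤ.* + n ℤ.≤ j ℤ.* + m)
  /≤/ = mk⇔
    (λ le → uncross m n (ℚᵘ.≤-respʳ-≃ j/n≃ (ℚᵘ.≤-respˡ-≃ i/m≃ (toℚᵘ-mono-≤ le))))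
    (λ le → toℚᵘ-cancel-≤ (ℚᵘ.≤-respʳ-≃ (ℚᵘ.≃-sym j/n≃)
              (ℚᵘ.≤-respˡ-≃ (ℚᵘ.≃-sym i/m≃) (cross m n le))))
    where
    cross : ∀ m n .{{_ : ℕ.NonZero m}} .{{_ : ℕ.NonZero n}} →
            i ℤ.* + n ℤ.≤ j ℤ.* + m → i ℚᵘ./ m ℚᵘ.≤ j ℚᵘ./ n
    cross (suc _) (suc _) = ℚᵘ.*≤*
    uncross : ∀ m n .{{_ : ℕ.NonZero m}} .{{_ : ℕ.NonZero n}} →
              i ℚᵘ./ m ℚᵘ.≤ j ℚᵘ./ n → i ℤ.* + n ℤ.≤ j ℤ.* + m
    uncross (suc _) (suc _) = ℚᵘ.drop-*≤*

/+/ : ∀ i j m n .{{_ : ℕ.NonZero m}} .{{_ : ℕ.NonZero n}} →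
      i / m + j / n ≡ ((i ℤ.* + n ℤ.+ j ℤ.* + m) / (m ℕ.* n)) {{ℕ.m*n≢0 m n}}
/+/ i j m@(suc _) n@(suc _) = toℚᵘ-injective (begin
  toℚᵘ (i / m + j / n)                      ≈⟨ toℚᵘ-homo-+ (i / m) (j / n) ⟩
  toℚᵘ (i / m) ℚᵘ.+ toℚᵘ (j / n)            ≈⟨ ℚᵘ.+-cong (toℚᵘ-/ i m) (toℚᵘ-/ j n) ⟩
  (i ℤ.* + n ℤ.+ j ℤ.* + m) ℚᵘ./ (m ℕ.* n)  ≈⟨ toℚᵘ-/ _ (m ℕ.* n) ⟨
  toℚᵘ ((i ℤ.* + n ℤ.+ j ℤ.* + m) / (m ℕ.* n)) ∎)
  where open import Relation.Binary.Reasoning.Setoid ℚᵘ.≃-setoid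

m/n*n/m≡1 : ∀ m n .{{_ : ℕ.NonZero m}} .{{_ : ℕ.NonZero n}} →
            (+ m / n) * (+ n / m) ≡ 1ℚ
m/n*n/m≡1 m@(suc _) n@(suc _) = toℚᵘ-injective (begin
  toℚᵘ ((+ m / n) * (+ n / m))        ≈⟨ toℚᵘ-homo-* (+ m / n) (+ n / m) ⟩
  toℚᵘ (+ m / n) ℚᵘ.* toℚᵘ (+ n / m)  ≈⟨ ℚᵘ.*-cong (toℚᵘ-/ (+ m) n) (toℚᵘ-/ (+ n) m) ⟩
  (+ m ℚᵘ./ n) ℚᵘ.* (+ n ℚᵘ./ m)      ≈⟨ ℚᵘ.*-inverseʳ (+ m ℚᵘ./ n) ⟩
  toℚᵘ 1ℚ                             ∎)
  where open import Relation.Binary.Reasoning.Setoid ℚᵘ.≃-setoid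

m/n>0 : ∀ m n .{{_ : ℕ.NonZero m}} .{{_ : ℕ.NonZero n}} → 0ℚ < + m / n
m/n>0 m n = positive⁻¹ (+ m / n) {{normalize-pos m n}}

-- Rational bounds, reciprocals and floors in terms of cuts.

L-down-≤ : ∀ x {p q} → p ≤ q → L x q → L x p
L-down-≤ x p≤q Lq = let r , q<r , Lr = L-open x Lq in L-down x (≤-<-trans p≤q q<r) Lr

U-up-≤ : ∀ x {p q} → p ≤ q → U x p → U x q
U-up-≤ x p≤q Up = let r , r<p , Ur = U-open x Up in U-up x (<-≤-trans r<p p≤q) Ur

<ᵣ⇔L : ∀ x {p} → (fromℚ p <ᵣ x) ⇔ L x p
<ᵣ⇔L x = mk⇔ (λ (_ , p<q , Lq) → L-down x p<q Lq) (L-open x)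

-- Constructively valid in both directions because the order on `ℚ` is decidable: refuting `p ≤ q`
-- yields `q < p`.
≤ᵣ⇔¬L : ∀ x {p} → (x ≤ᵣ fromℚ p) ⇔ (¬ L x p)
≤ᵣ⇔¬L x = mk⇔ (λ x≤p Lp → <-irrefl refl (x≤p Lp))
              (λ ¬Lp {q} Lq → ≰⇒> (λ p≤q → ¬Lp (L-down-≤ x p≤q Lq)))

-- Locatedness extracts positive information from the negation: `q < p` puts `q` in `L x` or `p` in
-- `U x`, and the latter is excluded.
≥ᵣ⇔¬U : ∀ x {p} → (fromℚ p ≤ᵣ x) ⇔ (¬ U x p)
≥ᵣ⇔¬U x {p} = mk⇔
  (λ p≤x Up → let q , q<p , Uq = U-open x Up in <-irrefl refl (L<U x (p≤x q<p) Uq))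
  (λ ¬Up {q} q<p → fromInj₁ (λ Up → ⊥-elim (¬Up Up)) (located x q<p))

-- The left-hand side is U (1/ᵣ x 0<x) q, which does not depend on 0<x.
U-1/ᵣ⇔L : ∀ x {p} q → 0ℚ < p → q * p ≡ 1ℚ →
          (∃[ r ] L x r × 0ℚ < r × 1ℚ < q * r) ⇔ L x p
U-1/ᵣ⇔L x {p = p} q 0<p qp≡1 = mk⇔
  (λ (r , Lr , _ , 1<qr) → L-down x (*-cancelˡ-<-nonNeg q {{pos⇒nonNeg q}} {p}
                                      (subst (_< q * r) (sym qp≡1) 1<qr)) Lr)
  (λ Lp → let r , p<r , Lr = L-open x Lp in
     r , Lr , <-trans 0<p p<r
       , subst (_< q * r) qp≡1 (*-monoʳ-<-pos q p<r))
  where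
  instance
    q>0 : Positive q
    q>0 = positive (cancel-* {0ℚ} {q} 0<p
            (subst (_< q * p) (sym (*-zeroˡ p)) (subst (0ℚ <_) (sym qp≡1) 0<1)))

-- Integrality sharpens `⌊ f ⌋ < n` to `⌊ f ⌋ + 1 ≤ n`, and x lies below `⌊ f ⌋ + 1`; conversely n ≤
-- `⌊ f ⌋` would give n ≤ x.
⌊⌋<⇔U : ∀ {x} (f : Floor x) n → (⌊ f ⌋ ℤ.< n) ⇔ U x (n / 1)
⌊⌋<⇔U {x} f n = mk⇔
  (λ ⌊x⌋<n → U-up-≤ x
    (/1-mono (subst (ℤ._≤ n) (ℤ.+-comm (+ 1) ⌊ f ⌋) (ℤ.i<j⇒suc[i]≤j ⌊x⌋<n)))
    (let _ , Uq , q<⌊x⌋+1 = upper f in U-up x q<⌊x⌋+1 Uq))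
  (λ Un → ℤ.≰⇒> (λ n≤⌊x⌋ →
    Equivalence.to (≥ᵣ⇔¬U x) (lower f) (U-up-≤ x (/1-mono n≤⌊x⌋) Un)))
  where
  /1-mono : ∀ {i j} → i ℤ.≤ j → i / 1 ≤ j / 1
  /1-mono {i} {j} i≤j = Equivalence.from (/≤/ i j 1 1) (ℤ.*-monoʳ-≤-nonNeg (+ 1) i≤j)

-- As G(x) = ⌊1/x⌋ + 1, this characterises G(x) as the least n with 1/n < x. It serves both for
-- 1/a_m < e_{m-1} and for condition i.
⌊recip⌋<⇔L : ∀ x u (f : Floor (recip x u)) n .{{_ : ℕ.NonZero n}} →
             (⌊ f ⌋ ℤ.< + n) ⇔ L x (+ 1 / n)
⌊recip⌋<⇔L x u f n = U-1/ᵣ⇔L x (+ n / 1) (m/n>0 1 n) (m/n*n/m≡1 n 1) ⇔-∘ ⌊⌋<⇔U f (+ n)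

L-remainder : ∀ θ a {{_ : ∀ {n} → ℕ.NonZero (a n)}} n q →
              L (remainder θ a (suc n)) q ⇔ L (remainder θ a n) (q + + 1 / a (suc n))
L-remainder θ a n q = mk⇔ (subst (L θ) assoc) (subst (L θ) (sym assoc))
  where
  open +-*-Solver
  assoc = solve 3 (λ q s i → q :+ (s :+ i) := q :+ i :+ s) refl
            q (partialSum θ a n) (+ 1 / a (suc n))

-- Conditions i, ii and iii compared with N/c, where c = Na - 1.

module _ (N a c : ℕ) .{{_ : ℕ.NonZero N}} .{{_ : ℕ.NonZero a}} .{{_ : ℕ.NonZero c}}
         (1+c≡N*a : suc c ≡ N ℕ.* a) where

  private
    instance
      a*c≢0 : ℕ.NonZero (a ℕ.* c)
      a*c≢0 = ℕ.m*n≢0 a c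
      N*a≢0 : ℕ.NonZero (N ℕ.* a)
      N*a≢0 = ℕ.m*n≢0 N a

    -- The ring identities over `ℤ` use c through this relation, which keeps truncated subtraction
    -- out of them.
    1+C≡N*A : + 1 ℤ.+ + c ≡ + N ℤ.* + a
    1+C≡N*A = trans (cong +_ 1+c≡N*a) (ℤ.pos-* N a)

    N/N*a≡1/a : + N / (N ℕ.* a) ≡ + 1 / a
    N/N*a≡1/a = /≡/ (+ N) (+ 1) (N ℕ.* a) a
      (trans (sym (ℤ.pos-* N a)) (sym (ℤ.*-identityˡ (+ (N ℕ.* a)))))

    -- The sum is (1 + c)/(ac) = Na/(ac). It carries the bound 1/(ac) on e_m over to the bound N/c
    -- on e_{m-1}.
    1/ac+1/a≡N/c : + 1 / (a ℕ.* c) + + 1 / a ≡ + N / c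
    1/ac+1/a≡N/c = trans (/+/ (+ 1) (+ 1) (a ℕ.* c) a)
      (/≡/ (+ 1 ℤ.* + a ℤ.+ + 1 ℤ.* + (a ℕ.* c)) (+ N) (a ℕ.* c ℕ.* a) c {{ℕ.m*n≢0 (a ℕ.* c) a}} cross)
      where
      open ≡-Reasoning
      open ℤ.+-*-Solver
      cross : (+ 1 ℤ.* + a ℤ.+ + 1 ℤ.* + (a ℕ.* c)) ℤ.* + c ≡ + N ℤ.* + (a ℕ.* c ℕ.* a)
      cross = begin
        (+ 1 ℤ.* + a ℤ.+ + 1 ℤ.* + (a ℕ.* c)) ℤ.* + c
          ≡⟨ cong (λ k → (+ 1 ℤ.* + a ℤ.+ + 1 ℤ.* k) ℤ.* + c) (ℤ.pos-* a c) ⟩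
        (+ 1 ℤ.* + a ℤ.+ + 1 ℤ.* (+ a ℤ.* + c)) ℤ.* + c
          ≡⟨ solve 2 (λ a c → (con (+ 1) :* a :+ con (+ 1) :* (a :* c)) :* c
                           := (con (+ 1) :+ c) :* (a :* c)) refl (+ a) (+ c) ⟩
        (+ 1 ℤ.+ + c) ℤ.* (+ a ℤ.* + c)
          ≡⟨ cong (ℤ._* (+ a ℤ.* + c)) 1+C≡N*A ⟩
        + N ℤ.* + a ℤ.* (+ a ℤ.* + c)
          ≡⟨ solve 3 (λ N a c → N :* a :* (a :* c) := N :* (a :* c :* a)) refl (+ N) (+ a) (+ c) ⟩
        + N ℤ.* (+ a ℤ.* + c ℤ.* + a)
          ≡⟨ cong (λ k → + N ℤ.* (k ℤ.* + a)) (ℤ.pos-* a c) ⟨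
        + N ℤ.* (+ (a ℕ.* c) ℤ.* + a)
          ≡⟨ cong (+ N ℤ.*_) (ℤ.pos-* (a ℕ.* c) a) ⟨
        + N ℤ.* + (a ℕ.* c ℕ.* a) ∎

    -- Read as a - 1/N = c/N, this produces the reciprocal of N/c needed for condition iii.
    c/N+1/N≡a : + c / N + + 1 / N ≡ + a / 1
    c/N+1/N≡a = trans (/+/ (+ c) (+ 1) N N)
      (/≡/ (+ c ℤ.* + N ℤ.+ + 1 ℤ.* + N) (+ a) (N ℕ.* N) 1 {{ℕ.m*n≢0 N N}} cross)
      where
      open ≡-Reasoning
      open ℤ.+-*-Solver
      cross : (+ c ℤ.* + N ℤ.+ + 1 ℤ.* + N) ℤ.* + 1 ≡ + a ℤ.* + (N ℕ.* N)
      cross = begin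
        (+ c ℤ.* + N ℤ.+ + 1 ℤ.* + N) ℤ.* + 1
          ≡⟨ solve 2 (λ c N → (c :* N :+ con (+ 1) :* N) :* con (+ 1)
                           := (con (+ 1) :+ c) :* N) refl (+ c) (+ N) ⟩
        (+ 1 ℤ.+ + c) ℤ.* + N
          ≡⟨ cong (ℤ._* + N) 1+C≡N*A ⟩
        + N ℤ.* + a ℤ.* + N
          ≡⟨ solve 2 (λ N a → N :* a :* N := a :* (N :* N)) refl (+ N) (+ a) ⟩
        + a ℤ.* (+ N ℤ.* + N)
          ≡⟨ cong (+ a ℤ.*_) (ℤ.pos-* N N) ⟨
        + a ℤ.* + (N ℕ.* N) ∎

    Naa-a≡ac : + N ℤ.* (+ a ℤ.* + a) ℤ.- + a ≡ + (a ℕ.* c)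
    Naa-a≡ac = begin
      + N ℤ.* (+ a ℤ.* + a) ℤ.- + a
        ≡⟨ solve 2 (λ N a → N :* (a :* a) :- a := N :* a :* a :- a) refl (+ N) (+ a) ⟩
      + N ℤ.* + a ℤ.* + a ℤ.- + a
        ≡⟨ cong (λ i → i ℤ.* + a ℤ.- + a) (sym 1+C≡N*A) ⟩
      (+ 1 ℤ.+ + c) ℤ.* + a ℤ.- + a
        ≡⟨ solve 2 (λ a c → (con (+ 1) :+ c) :* a :- a := a :* c) refl (+ a) (+ c) ⟩
      + a ℤ.* + c
        ≡⟨ ℤ.pos-* a c ⟨
      + (a ℕ.* c) ∎
      where
      open ≡-Reasoning
      open ℤ.+-*-Solver

  -- Here x is e_{m-1} and y is e_m. Since G(y) = ⌊1/y⌋ + 1, the bound ac + 1 on G(y) denies ⌊1/y⌋ <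
  -- ac, that is, 1/(ac) < y.
  next≥⇔¬L : ∀ x y u (f : Floor (recip y u)) → (∀ {q} → L y q ⇔ L x (q + + 1 / a)) →
             (G y u f ℤ.≥ + N ℤ.* (+ a ℤ.* + a) ℤ.- + a ℤ.+ + 1) ⇔ (¬ L x (+ N / c))
  next≥⇔¬L x y u f y≡x-1/a rewrite Naa-a≡ac | sym 1/ac+1/a≡N/c =
    ¬-cong-⇔ (y≡x-1/a ⇔-∘ ⌊recip⌋<⇔L y u f (a ℕ.* c)) ⇔-∘ mk⇔
      (λ ac+1≤G ⌊⌋<ac → ℤ.≤⇒≯ ac+1≤G (ℤ.+-monoˡ-< (+ 1) ⌊⌋<ac))
      (λ ⌊⌋≮ac → ℤ.+-monoˡ-≤ (+ 1) (ℤ.≮⇒≥ ⌊⌋≮ac))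

  largestBelow≡⇔¬L : ∀ x b .{{_ : ℕ.NonZero b}} → IsLargestBelow N b x → L x (+ 1 / a) →
                     (+ 1 / a ≡ + N / b) ⇔ (¬ L x (+ N / c))
  largestBelow≡⇔¬L x b isLargest L1/a = mk⇔
    -- If N/c < x, maximality gives N/c ≤ N/b = N/(Na), so Na ≤ c, against 1 + c = Na.
    (λ 1/a≡N/b LN/c → ℕ.<-irrefl refl (ℕ.≤-trans (ℕ.≤-reflexive 1+c≡N*a)
      (N/-cancel-≤ (subst (+ N / c ≤_) (trans (sym 1/a≡N/b) (sym N/N*a≡1/a))
                  (largest isLargest c (Equivalence.from (<ᵣ⇔L x) LN/c))))))
    (λ ¬LN/c → ≤-antisym
      (subst (_≤ + N / b) N/N*a≡1/a (largest isLargest (N ℕ.* a)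
        (Equivalence.from (<ᵣ⇔L x) (subst (L x) (sym N/N*a≡1/a) L1/a))))
      (subst (+ N / b ≤_) N/N*a≡1/a (N/-anti-≤
        -- If b ≤ c, then N/c ≤ N/b < x; hence c < b, which is Na ≤ b.
        (subst (ℕ._≤ b) 1+c≡N*a (ℕ.≰⇒> λ b≤c → ¬LN/c
          (L-down-≤ x (N/-anti-≤ b≤c) (Equivalence.to (<ᵣ⇔L x) (below isLargest))))))))
    where
    N/-cancel-≤ : ∀ {m n} .{{_ : ℕ.NonZero m}} .{{_ : ℕ.NonZero n}} → + N / m ≤ + N / n → n ℕ.≤ m
    N/-cancel-≤ {m} {n} le = ℤ.drop‿+≤+ (ℤ.*-cancelˡ-≤-pos (+ n) (+ m) (+ N) {{ℤ.positive (ℤ.+<+ (ℕ.>-nonZero⁻¹ N))}}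
      (Equivalence.to (/≤/ (+ N) (+ N) m n) le))
    N/-anti-≤ : ∀ {m n} .{{_ : ℕ.NonZero m}} .{{_ : ℕ.NonZero n}} → n ℕ.≤ m → + N / m ≤ + N / n
    N/-anti-≤ {m} {n} n≤m = Equivalence.from (/≤/ (+ N) (+ N) m n)
      (ℤ.*-monoˡ-≤-nonNeg (+ N) (ℤ.+≤+ n≤m))

  N≤Φ⇔¬L : ∀ x u (f : Floor (recip x u)) → + a ≡ G x u f →
           (fromℤ (+ N) ≤ᵣ Φ x u f) ⇔ (¬ L x (+ N / c))
  N≤Φ⇔¬L x u f a≡G =
    -- The two inversions compose without a lemma between them: 1/N < 1 - (1/x - k) unfolds by
    -- definition to 1/x < 1 - 1/N + k.
    ¬-cong-⇔ (U-1/ᵣ⇔L x (1ℚ - + 1 / N + k) (m/n>0 N c) 1-1/N+⌊⌋*N/c≡1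
              ⇔-∘ U-1/ᵣ⇔L (1ℚ ℚ- frac (recip x u) f) (+ N / 1) (m/n>0 1 N) (m/n*n/m≡1 N 1))
    ⇔-∘ ≥ᵣ⇔¬U (Φ x u f)
    where
    open ≡-Reasoning
    open +-*-Solver
    k = ⌊ f ⌋ / 1
    -- Since k + 1 = G(x) = a, the first factor is a - 1/N = c/N.
    1-1/N+⌊⌋*N/c≡1 : (1ℚ - + 1 / N + k) * (+ N / c) ≡ 1ℚ
    1-1/N+⌊⌋*N/c≡1 = trans (cong (_* (+ N / c)) (begin
      1ℚ - + 1 / N + k            ≡⟨ solve 2 (λ ν k → con 1ℚ :- ν :+ k := k :+ con 1ℚ :- ν) refl (+ 1 / N) k ⟩
      k + 1ℚ - + 1 / N            ≡⟨ cong (_- + 1 / N) (sym ([k+1]/1 ⌊ f ⌋)) ⟩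
      G x u f / 1 - + 1 / N       ≡⟨ cong (λ i → i / 1 - + 1 / N) (sym a≡G) ⟩
      + a / 1 - + 1 / N           ≡⟨ cong (_- + 1 / N) (sym c/N+1/N≡a) ⟩
      + c / N + + 1 / N - + 1 / N ≡⟨ p+q-q≡p (+ c / N) (+ 1 / N) ⟩
      + c / N                     ∎)) (m/n*n/m≡1 c N)

theorem1p5 :
  (N : ℕ) .{{_ : ℕ.NonZero N}}
  (θ : ℝ) (θ∈ : θ ∈⟨0,1])
  (a : ℕ → ℕ) {{_ : ∀ {n} → ℕ.NonZero (a n)}} (greedy : IsGreedy θ a)
  (m-1 : ℕ) (b : ℕ) .{{_ : ℕ.NonZero b}} →
  IsLargestBelow N b (remainder θ a m-1) →
  let m    = suc m-1
      e     = remainder θ a m-1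
      e∈    = remainder∈⟨0,1] θ a θ∈ greedy m-1
      ⌊1/e⌋ = proj₁ (greedy m-1 e∈)
      i    = + a (suc m) ℤ.≥ + N ℤ.* (+ a m ℤ.* + a m) ℤ.- + a m ℤ.+ + 1
      ii   = + 1 / a m ≡ + N / b
      iii  = fromℤ (+ N) ≤ᵣ Φ e e∈ ⌊1/e⌋
      iv   = e ≤ᵣ fromℚ ((+ N / (N ℕ.* a m ℕ.∸ 1)) {{N*a∸1≢0 θ a θ∈ greedy N m-1}})
  in (i ⇔ ii) × (ii ⇔ iii) × (iii ⇔ iv)
theorem1p5 N θ θ∈ a greedy m-1 b isLargest =
  -- The local `i`, `ii`, `iii` are the equivalences of the respective statements with
  -- `¬ L e (+ N / c)`.
  ⇔-sym ii ⇔-∘ i , ⇔-sym iii ⇔-∘ ii , ⇔-sym (≤ᵣ⇔¬L e) ⇔-∘ iii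
  where
  m   = suc m-1
  e   = remainder θ a m-1
  e∈  = remainder∈⟨0,1] θ a θ∈ greedy m-1
  e′  = remainder θ a m
  e′∈ = remainder∈⟨0,1] θ a θ∈ greedy m
  f   = proj₁ (greedy m-1 e∈)
  f′  = proj₁ (greedy m e′∈)
  a≡G = proj₂ (greedy m-1 e∈)
  c   = N ℕ.* a m ℕ.∸ 1
  instance
    -- As e_{m-1} ≤ 1, the greedy term a_m is at least 2, so N a_m - 1 ≥ 1.
    c≢0 : ℕ.NonZero c
    c≢0 = N*a∸1≢0 θ a θ∈ greedy N m-1
  1+c≡N*a : suc c ≡ N ℕ.* a m
  -- The truncated subtraction in c is exact because N a_m ≥ 1.
  1+c≡N*a = ℕ.m+[n∸m]≡n (ℕ.>-nonZero⁻¹ (N ℕ.* a m) {{ℕ.m*n≢0 N (a m)}})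
  1/a<e : L e (+ 1 / a m)
  1/a<e = Equivalence.to (⌊recip⌋<⇔L e e∈ f (a m))
    -- The required ⌊1/e⌋ < a_m holds because a_m = ⌊1/e⌋ + 1.
    (subst (⌊ f ⌋ ℤ.<_) (sym a≡G) (ℤ.≤-<-trans (ℤ.≤-reflexive (sym (ℤ.+-identityʳ ⌊ f ⌋)))
      (ℤ.+-monoʳ-< ⌊ f ⌋ (ℤ.+<+ ℕ.z<s))))
  i : (+ a (suc m) ℤ.≥ + N ℤ.* (+ a m ℤ.* + a m) ℤ.- + a m ℤ.+ + 1) ⇔ (¬ L e (+ N / c))
  -- Greediness at the next index identifies a_{m+1} with G(e_m).
  i = subst (λ k → (k ℤ.≥ + N ℤ.* (+ a m ℤ.* + a m) ℤ.- + a m ℤ.+ + 1) ⇔ (¬ L e (+ N / c))) (sym (proj₂ (greedy m e′∈)))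
    (next≥⇔¬L N (a m) c 1+c≡N*a e e′ e′∈ f′ (λ {q} → L-remainder θ a m-1 q))
  ii  = largestBelow≡⇔¬L N (a m) c 1+c≡N*a e b isLargest 1/a<e
  iii = N≤Φ⇔¬L N (a m) c 1+c≡N*a e e∈ f a≡G
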